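{- Let $\mathcal A$ be a full adjunction implicative ordered combinatory algebra with underlying complete lattice $(A,\le)$, and let $\mathcal P_\bullet(A_\Pi)$ be computed in the associated abstract Krivine structure $\mathcal K_{\mathcal A\bullet}$ (where $\Pi=A$ and $s\perp\pi\iff s\le\pi$), ordered by $C\le C'\iff C\supseteq C'$. Define $\iota:A\to\mathcal P_\bullet(A_\Pi)$, $\iota(a)={\uparrow}a=\{x\in A:a\le x\}$, and $\rho:\mathcal P_\bullet(A_\Pi)\to A$, $\rho(C)=\inf C$. Then $\iota,\rho$ are monotone and form a Galois connection $\iota\dashv\rho$: for $a\in A$ and $C\in\mathcal P_\bullet(A_\Pi)$, $a\le\rho(C)\iff\iota(a)\supseteq C$. Moreover $\rho\circ\iota=\mathrm{id}_A$, and $\iota(\rho(C))\supseteq C$ for all $C\in\mathcal P_\bullet(A_\Pi)$.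
   Context: A full adjunction implicative ordered combinatory algebra is an inf-complete poset $(A,\le)$ with application $ab$ monotone in both arguments, implication $a\to b$ antimonotone in the first and monotone in the second argument, elements $\mathsf k,\mathsf s$ with $\mathsf k ab\le a$, $\mathsf s abc\le ac(bc)$, such that $a\le b\to c\iff ab\le c$, and a subset $\Phi\subseteq A$ closed under application containing $\mathsf s,\mathsf k$. In $\mathcal K_{\mathcal A\bullet}$, $\Lambda=\Pi=A$ and $t\perp\pi$ iff $t\le\pi$. Polars: $L^\perp=\{\pi:\forall t\in L,\ t\le\pi\}$, ${}^\perp P=\{t:\forall\pi\in P,\ t\le\pi\}$; $\overline P=({}^\perp P)^\perp$; $\widehat P=\bigcup_{\pi\in P}\overline{\{\pi\}}$; $\mathcal P_\bullet(A_\Pi)=\{P\subseteq A:\widehat P=P\}$. -}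

module Defs where

open import Data.Product using (∃-syntax; _×_; _,_)
open import Function.Bundles using (_⇔_)
open import Level using (Level; suc)
open import Relation.Binary.Bundles using (Setoid; Poset)
open import Relation.Binary.Core using (REL; Rel)
open import Relation.Binary.Definitions
  using (Monotonic₂; AntitonicMonotonic; _Respectsˡ_; _Respectsʳ_)
open import Relation.Unary using (Pred; _∈_; _⊇_; _≐_)

private
  variable
    ℓ : Level

-- A single level ℓ is used throughout, so that the powerset Pred A ℓ of a
-- carrier A : Set ℓ is closed under polars, closures and unions.

module _ (P : Poset ℓ ℓ ℓ) where
  open Poset P

  record IsInfimum (S : Pred Carrier ℓ) (x : Carrier) : Set ℓ where
    field
      lower    : ∀ y → y ∈ S → x ≤ y
      greatest : ∀ z → (∀ y → y ∈ S → z ≤ y) → z ≤ x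

record FullAdjunctionIOCA ℓ : Set (suc ℓ) where
  infixl 8 _·_
  infixr 7 _⇒_

  field
    poset : Poset ℓ ℓ ℓ

  open Poset poset public

  field
    inf           : Pred Carrier ℓ → Carrier
    inf-isInfimum : ∀ S → IsInfimum poset S (inf S)

    _·_    : Carrier → Carrier → Carrier
    _⇒_    : Carrier → Carrier → Carrier
    ·-mono : Monotonic₂ _≤_ _≤_ _≤_ _·_
    ⇒-mono : AntitonicMonotonic _≤_ _≤_ _≤_ _⇒_

    k s : Carrier
    k-≤ : ∀ a b → k · a · b ≤ a
    s-≤ : ∀ a b c → s · a · b · c ≤ a · c · (b · c)

    adjunction : ∀ a b c → (a ≤ b ⇒ c) ⇔ (a · b ≤ c)

    Φ        : Pred Carrier ℓ
    -- Φ is a subset of the setoid (Carrier, ≈); automatic when ≈ is ≡.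
    Φ-resp-≈ : ∀ {a b} → a ≈ b → a ∈ Φ → b ∈ Φ
    Φ-·      : ∀ {a b} → a ∈ Φ → b ∈ Φ → a · b ∈ Φ
    k∈Φ      : k ∈ Φ
    s∈Φ      : s ∈ Φ

-- The part (Λ, Π, ⊥) of an abstract Krivine structure; polars, closures and
-- 𝒫• depend on nothing else.
record RealizabilityLattice ℓ : Set (suc ℓ) where
  infix 4 _⊥_
  field
    Λ-setoid Π-setoid : Setoid ℓ ℓ

  open Setoid Λ-setoid public using () renaming (Carrier to Λ; _≈_ to _≈Λ_)
  open Setoid Π-setoid public using () renaming (Carrier to Π; _≈_ to _≈Π_)

  field
    _⊥_     : REL Λ Π ℓ
    ⊥-respˡ : _⊥_ Respectsˡ _≈Λ_
    ⊥-respʳ : _⊥_ Respectsʳ _≈Π_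

module Polars (K : RealizabilityLattice ℓ) where
  open RealizabilityLattice K

  infix 9 _^⊥ ⊥^_

  _^⊥ : Pred Λ ℓ → Pred Π ℓ
  (L ^⊥) π = ∀ t → t ∈ L → t ⊥ π

  ⊥^_ : Pred Π ℓ → Pred Λ ℓ
  (⊥^ P) t = ∀ π → π ∈ P → t ⊥ π

  singleton : Π → Pred Π ℓ
  singleton π = λ σ → σ ≈Π π

  closure : Pred Π ℓ → Pred Π ℓ
  closure P = (⊥^ P) ^⊥

  hat : Pred Π ℓ → Pred Π ℓ
  hat P σ = ∃[ π ] π ∈ P × σ ∈ closure (singleton π)

  record 𝒫• : Set (suc ℓ) where
    constructor mk𝒫•
    field
      ⌊_⌋    : Pred Π ℓ
      closed : hat ⌊_⌋ ≐ ⌊_⌋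

  open 𝒫• public

  infix 4 _⊑_

  _⊑_ : Rel 𝒫• ℓ
  C ⊑ C′ = ⌊ C ⌋ ⊇ ⌊ C′ ⌋

𝒦• : FullAdjunctionIOCA ℓ → RealizabilityLattice ℓ
𝒦• 𝒜 = record
  { Λ-setoid = Eq.setoid
  ; Π-setoid = Eq.setoid
  ; _⊥_      = _≤_
  ; ⊥-respˡ  = ≤-respˡ-≈
  ; ⊥-respʳ  = ≤-respʳ-≈
  }
  where
  open FullAdjunctionIOCA 𝒜

module Adjunction (𝒜 : FullAdjunctionIOCA ℓ) where
  open FullAdjunctionIOCA 𝒜
  open Polars (𝒦• 𝒜) public

  ↑_ : Carrier → Pred Carrier ℓ
  ↑ a = λ x → a ≤ x

  ↑-closed : ∀ a → hat (↑ a) ≐ (↑ a)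
  ↑-closed a =
      (λ (π , a≤π , σ∈) → σ∈ a λ τ τ≈π → ≤-respʳ-≈ (Eq.sym τ≈π) a≤π)
    , (λ {σ} a≤σ → σ , a≤σ , λ t t∈ → t∈ σ Eq.refl)

  ι : Carrier → 𝒫•
  ι a = mk𝒫• (↑ a) (↑-closed a)

  ρ : 𝒫• → Carrier
  ρ C = inf ⌊ C ⌋

{-# OPTIONS --safe #-}
module Submission where

open import Defs
open import Data.Product using (_×_; _,_)
open import Function.Bundles using (_⇔_; mk⇔)
open import Relation.Binary.Definitions using (Monotonic₁; Adjoint)
open import Relation.Unary using (_⊇_)

-- Saying that `a` is a lower bound of `S` is saying `↑ a ⊇ S`, so the universal property of `inf S`
-- is already the Galois connection; `inf-lower` and `inf-greatest` are its two halves.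

module _ {ℓ} (𝒜 : FullAdjunctionIOCA ℓ) where
  open FullAdjunctionIOCA 𝒜
  open Adjunction 𝒜

  inf-lower : ∀ S → ↑ (inf S) ⊇ S
  inf-lower S = IsInfimum.lower (inf-isInfimum S) _

  inf-greatest : ∀ a S → ↑ a ⊇ S → a ≤ inf S
  inf-greatest a S S⊆↑a = IsInfimum.greatest (inf-isInfimum S) a λ _ y∈S → S⊆↑a y∈S

  ≤inf⇒↑⊇ : ∀ a S → a ≤ inf S → ↑ a ⊇ S
  ≤inf⇒↑⊇ a S a≤inf y∈S = trans a≤inf (inf-lower S y∈S)

  -- By reflexivity `a` is the least element of `↑ a`, hence its infimum.
  inf-↑ : ∀ a → inf (↑ a) ≈ a
  inf-↑ a = antisym (inf-lower (↑ a) refl) (inf-greatest a (↑ a) λ a≤x → a≤x)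

mainTheorem13 : ∀ {ℓ} (𝒜 : FullAdjunctionIOCA ℓ) →
    let open FullAdjunctionIOCA 𝒜
        open Adjunction 𝒜
    in  Monotonic₁ _≤_ _⊑_ ι
      × Monotonic₁ _⊑_ _≤_ ρ
      × Adjoint _≤_ _⊑_ ι ρ
      × (∀ a (C : 𝒫•) → (a ≤ ρ C) ⇔ (⌊ ι a ⌋ ⊇ ⌊ C ⌋))
      × (∀ a → ρ (ι a) ≈ a)
      × (∀ (C : 𝒫•) → ⌊ ι (ρ C) ⌋ ⊇ ⌊ C ⌋)
mainTheorem13 𝒜 =
    (λ a≤b b≤x → trans a≤b b≤x)
  -- A lower bound of `C` also bounds the smaller set `C′`.
  , (λ {C} {C′} C⊇C′ →
       inf-greatest 𝒜 (ρ C) ⌊ C′ ⌋ λ x∈C′ → inf-lower 𝒜 ⌊ C ⌋ (C⊇C′ x∈C′))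
  -- `ι a ⊑ C` unfolds to `↑ a ⊇ ⌊ C ⌋`.
  , (λ {a} {C} → inf-greatest 𝒜 a ⌊ C ⌋ , ≤inf⇒↑⊇ 𝒜 a ⌊ C ⌋)
  , (λ a C → mk⇔ (≤inf⇒↑⊇ 𝒜 a ⌊ C ⌋) (inf-greatest 𝒜 a ⌊ C ⌋))
  , inf-↑ 𝒜
  -- The counit `ι (ρ C) ⊑ C`.
  , (λ C → inf-lower 𝒜 ⌊ C ⌋)
  where
  open FullAdjunctionIOCA 𝒜
  open Adjunction 𝒜
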